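{- For every two integers $n$ and $k$ with $2\leq k\leq n$, the complete graph $K_n$ satisfies $$\lambda_k(K_n)=n-\lceil k/2\rceil.$$
   Context: All graphs are undirected, finite and simple. For a graph $G$ and a set $S\subseteq V(G)$ of at least two vertices, a tree connecting $S$ (an $S$-Steiner tree) is a subgraph $T$ of $G$ that is a tree with $S\subseteq V(T)$. Let $\lambda(S)$ be the maximum number of pairwise edge-disjoint trees connecting $S$ in $G$. The generalized $k$-edge-connectivity of $G$ is $\lambda_k(G)=\min\{\lambda(S) : S\subseteq V(G),\ |S|=k\}$. -}

module Defs where

open import Data.Fin using (Fin; zero; suc; fromℕ; inject₁; _≟_)
open import Data.Fin.Subset using (Subset; _∈_; _⊆_; ∣_∣; Nonempty)
open import Data.Nat using (ℕ; _+_; _≤_)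
open import Data.Nat.Properties using (≤-antisym)
open import Data.Product using (∃; _×_; _,_)
open import Function.Definitions using (Injective)
open import Level using (0ℓ)
open import Relation.Binary using (Rel; Decidable; Symmetric; Irreflexive)
open import Relation.Binary.Construct.Closure.ReflexiveTransitive using (Star)
open import Relation.Binary.PropositionalEquality using (_≡_; _≢_; refl; ≢-sym)
open import Relation.Nullary using (¬_)
open import Relation.Nullary.Decidable using (¬?)

-- Decidability of adjacency is part of the data: constructively, it is what
-- makes the edge set of a graph on `Fin n` finite.
record Graph (n : ℕ) : Set₁ where
  field
    Adj    : Rel (Fin n) 0ℓ
    adj?   : Decidable Adj
    symm   : Symmetric Adj
    irrefl : Irreflexive _≡_ Adj

K : ∀ n → Graph n
K n = record
  { Adj    = _≢_
  ; adj?   = λ u v → ¬? (u ≟ v)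
  ; symm   = ≢-sym
  ; irrefl = λ u≡v u≢v → u≢v u≡v
  }

record Subgraph {n} (G : Graph n) : Set₁ where
  open Graph G using (Adj)
  field
    V     : Subset n
    E     : Rel (Fin n) 0ℓ
    edge? : Decidable E
    symm  : Symmetric E
    E⊆Adj : ∀ {u v} → E u v → Adj u v
    -- The other endpoint lies in V by symmetry.
    E⇒∈V  : ∀ {u v} → E u v → u ∈ V

-- A cycle of length 3 + m: distinct vertices c₀, …, c₍ₘ₊₂₎ with cᵢ adjacent
-- to cᵢ₊₁ and the last adjacent to the first.
record Cycle {n} (E : Rel (Fin n) 0ℓ) : Set where
  field
    m         : ℕ
    c         : Fin (3 + m) → Fin n
    injective : Injective _≡_ _≡_ c
    step      : ∀ (i : Fin (2 + m)) → E (c (inject₁ i)) (c (suc i))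
    close     : E (c (fromℕ (2 + m))) (c zero)

record IsTree {n} {G : Graph n} (T : Subgraph G) : Set where
  open Subgraph T
  field
    nonempty  : Nonempty V
    connected : ∀ {u v} → u ∈ V → v ∈ V → Star E u v
    acyclic   : ¬ Cycle E

record SteinerTree {n} (G : Graph n) (S : Subset n) : Set₁ where
  field
    subgraph : Subgraph G
    isTree   : IsTree subgraph
  open Subgraph subgraph public
  field
    S⊆V : S ⊆ V

EdgeDisjoint : ∀ {n} {G : Graph n} {S : Subset n} →
               SteinerTree G S → SteinerTree G S → Set
EdgeDisjoint T T′ = ∀ {u v} → SteinerTree.E T u v → ¬ SteinerTree.E T′ u v

record SteinerPacking {n} (G : Graph n) (S : Subset n) (m : ℕ) : Set₁ where
  field
    tree     : Fin m → SteinerTree G S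
    disjoint : ∀ {i j} → i ≢ j → EdgeDisjoint (tree i) (tree j)

-- `IsLocalλ G S l` says that λ(S) = l in G.  It is meant for 2 ≤ ∣ S ∣: for
-- smaller S there are edgeless trees containing S, and no maximum exists
-- (unless G has no vertices).
record IsLocalλ {n} (G : Graph n) (S : Subset n) (l : ℕ) : Set₁ where
  field
    packing : SteinerPacking G S l
    maximal : ∀ m → SteinerPacking G S m → m ≤ l

-- `IsGeneralizedλ G k l` says that λₖ(G) = l.  The field `minimal` also asserts
-- that each λ(S) exists; quantifying instead over all l′ with
-- `IsLocalλ G S l′` would say nothing, constructively, about an S whose λ(S)
-- has not been exhibited.
record IsGeneralizedλ {n} (G : Graph n) (k l : ℕ) : Set₁ where
  field
    attained : ∃ λ S → ∣ S ∣ ≡ k × IsLocalλ G S l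
    minimal  : ∀ S → ∣ S ∣ ≡ k → ∃ λ l′ → IsLocalλ G S l′ × l ≤ l′

-- The two relations are functional, so they do express equalities.

localλ-unique : ∀ {n} {G : Graph n} {S l l′} →
                IsLocalλ G S l → IsLocalλ G S l′ → l ≡ l′
localλ-unique p q = ≤-antisym (Q.maximal _ P.packing) (P.maximal _ Q.packing)
  where
  module P = IsLocalλ p
  module Q = IsLocalλ q

generalizedλ-unique : ∀ {n} {G : Graph n} {k l l′} →
                      IsGeneralizedλ G k l → IsGeneralizedλ G k l′ → l ≡ l′
generalizedλ-unique p q = ≤-antisym (le p q) (le q p)
  where
  le : ∀ {n} {G : Graph n} {k l l′} →
       IsGeneralizedλ G k l → IsGeneralizedλ G k l′ → l ≤ l′
  le p q with IsGeneralizedλ.attained q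
  ... | S , ∣S∣≡k , λS with IsGeneralizedλ.minimal p S ∣S∣≡k
  ...   | _ , λS′ , l≤ with localλ-unique λS′ λS
  ...     | refl = l≤

-- Upper bound.  Let k = |S|, and weight an edge inside S by 1/(k−1), an edge
-- leaving S by 1/k and all other edges by 0; the total is n − k/2.  A connected
-- subgraph containing S weighs at least 1: orient it towards a root, chosen
-- outside S whenever it has a vertex there, and charge to every vertex of S the
-- first edge on its way to the root.
--
-- Lower bound.  Each w ∉ S is the centre of a star on S ∪ {w}.  Inside S choose
-- ⌊k/2⌋ disjoint pairs (aᵢ , bᵢ).  The i-th double star consists of aᵢbᵢ, of
-- aᵢaⱼ and bᵢbⱼ for j > i, of bᵢaⱼ and aᵢbⱼ for j < i, and, if k is odd, of the
-- edge from aᵢ to the vertex left over.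
module Submission where

open import Data.Bool using (true; false; if_then_else_)
open import Data.Fin
  using (Fin; zero; suc; toℕ; fromℕ; inject₁; inject≤; combine; opposite; splitAt; join; _≟_)
  renaming (_<_ to _<ᶠ_; _>_ to _>ᶠ_)
open import Data.Fin.Induction using (<-wellFounded; >-wellFounded)
open import Data.Fin.Patterns using (0F; 1F; 2F)
open import Data.Fin.Properties
  using (0≢1+n; suc-injective; any?; toℕ-inject₁; inject≤-injective; combine-injective; join-splitAt)
import Data.Fin.Properties as Fin
open import Data.Fin.Relation.Unary.Top using (view; ‵fromℕ; ‵inject₁)
open import Data.Fin.Subset using (Subset; inside; outside; _∈_; _∉_; _⊆_; ∣_∣; _∪_; ⁅_⁆; ∁; ⊥)
open import Data.Fin.Subset.Properties
  using (_∈?_; x∈⁅x⁆; x∈⁅y⁆⇒x≡y; x∈p∪q⁻; p⊆p∪q; q⊆p∪q; x∈∁p⇒x∉p; ∣⊥∣≡0; ∣∁p∣≡n∸∣p∣)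
open import Data.Nat
  using (ℕ; zero; suc; _+_; _*_; _∸_; _≤_; _<_; _<?_; ⌊_/2⌋; ⌈_/2⌉; z≤n; s≤s; z<s; s<s)
open import Data.Nat.Properties
  using (m≢1+n+m; *-identityˡ; ≤-reflexive; +-mono-≤;
    +-identityʳ; +-assoc; *-zeroʳ; <-asym; m≤n+o⇒m∸n≤o; *-identityʳ; m≤n+m; *-monoˡ-≤;
    *-distribˡ-+; *-distribʳ-+; *-assoc; *-monoʳ-≤; ≤-trans; n≤1+n; m≤m+n; *-cancelˡ-≤;
    +-cancelˡ-≤; +-suc; n≡⌊n+n/2⌋; ⌊n/2⌋-mono; m+[n∸m]≡n; m∸n+n≡m; ⌊n/2⌋+⌈n/2⌉≡n; m+n∸n≡m;
    ≤-refl; +-*-semiring; module ≤-Reasoning)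
open import Algebra.Properties.Semiring.Sum +-*-semiring
  using (sum; sum-syntax; sum-cong-≗; sum-replicate-zero; ∑-distrib-+; ∑-comm; *-distribˡ-sum; *-distribʳ-sum)
open import Data.Nat.Solver using (module +-*-Solver)
open import Data.Product using (∃; ∃₂; _×_; _,_; proj₁; proj₂)
open import Data.Sum using (_⊎_; inj₁; inj₂; swap)
open import Data.Vec using ([]; _∷_; here; there)
open import Function using (_∘_; flip; case_of_; _∋_; Injective)
open import Induction.WellFounded using (Acc; acc)
open import Level using (0ℓ)
open import Relation.Binary using (Rel; Symmetric; Decidable; tri<; tri≈; tri>)
open import Relation.Binary.Construct.Closure.ReflexiveTransitive using (Star; ε; _◅_; _◅◅_; reverse)
import Relation.Binary.Construct.Union as Union
open import Relation.Binary.PropositionalEquality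
  using (_≡_; _≢_; refl; sym; trans; cong; cong₂; subst; subst₂; module ≡-Reasoning)
open import Relation.Nullary using (¬_; Dec; yes; no; does; contradiction)
open import Relation.Nullary.Decidable using (¬?; _×-dec_; dec-true; dec-false; decidable-stable)
import Relation.Unary as U

open import Defs

-- Trees given by parent functions.

-- The two neighbours are the cyclic successor and predecessor of `i`; their indices differ because
-- a cycle has length at least 3.
cycle-neighbours : ∀ {n} {E : Rel (Fin n) 0ℓ} → Symmetric E → (C : Cycle E) → let open Cycle C in
                   ∀ i → ∃₂ λ j k → j ≢ k × E (c i) (c j) × E (c i) (c k)
cycle-neighbours E-sym C i with view i
... | ‵fromℕ          = zero , inject₁ (fromℕ _) , (λ ()) , Cycle.close C , E-sym (Cycle.step C _)
... | ‵inject₁ zero    = suc zero , fromℕ _ , (λ ()) , Cycle.step C zero , E-sym (Cycle.close C)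
... | ‵inject₁ (suc j) = suc (suc j) , inject₁ (inject₁ j) , apart , Cycle.step C (suc j) , E-sym (Cycle.step C (inject₁ j))
  where
  apart : suc (suc j) ≢ inject₁ (inject₁ j)
  apart eq = m≢1+n+m _ (sym (trans (cong toℕ eq) (trans (toℕ-inject₁ (inject₁ j)) (toℕ-inject₁ j))))

-- A strictly decreasing `rank` replaces any inductive construction of the tree. It takes values in
-- a finite type, so that both orders on it are well-founded: one makes every path to the root end,
-- the other excludes cycles. `parent` and `rank` are constrained only at the vertices of `V` other
-- than the root.
record RootedTree (n : ℕ) : Set where
  field
    V           : Subset n
    root        : Fin n
    root∈V      : root ∈ V
    parent      : Fin n → Fin n
    {height}    : ℕ
    rank        : Fin n → Fin height
    parent∈V    : ∀ {u} → u ∈ V → u ≢ root → parent u ∈ V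
    rank-parent : ∀ {u} → u ∈ V → u ≢ root → rank (parent u) <ᶠ rank u

  Arc : Rel (Fin n) 0ℓ
  Arc u v = (u ∈ V × u ≢ root) × parent u ≡ v

  Edge : Rel (Fin n) 0ℓ
  Edge = Arc Union.∪ flip Arc

  arc? : Decidable Arc
  arc? u v = (u ∈? V ×-dec ¬? (u ≟ root)) ×-dec (parent u ≟ v)

  arc⇒rank> : ∀ {u v} → Arc u v → rank u >ᶠ rank v
  arc⇒rank> ((u∈V , u≢r) , refl) = rank-parent u∈V u≢r

  path-to-root : ∀ {u} → Acc _<ᶠ_ (rank u) → u ∈ V → Star Edge u root
  path-to-root {u} (acc rs) u∈V with u ≟ root
  ... | yes refl = ε
  ... | no u≢r   = inj₁ ((u∈V , u≢r) , refl) ◅ path-to-root (rs (rank-parent u∈V u≢r)) (parent∈V u∈V u≢r)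

  -- A vertex has only one parent, so of its two neighbours on a cycle one is a
  -- child: ranks along a cycle would have no maximum.
  acyclic : ¬ Cycle Edge
  acyclic C = no-maximum zero (>-wellFounded _)
    where
    open Cycle C
    ascend : ∀ i → ∃ λ j → rank (c j) >ᶠ rank (c i)
    ascend i with cycle-neighbours swap C i
    ... | j , _ , _ , inj₂ a , _ = j , arc⇒rank> a
    ... | _ , k , _ , _ , inj₂ a = k , arc⇒rank> a
    ... | _ , _ , j≢k , inj₁ (_ , p) , inj₁ (_ , q) = contradiction (injective (trans (sym p) q)) j≢k
    no-maximum : ∀ i → ¬ Acc _>ᶠ_ (rank (c i))
    no-maximum i (acc rs) with ascend i
    ... | j , gt = no-maximum j (rs gt)

  steinerTree : ∀ {S} → S ⊆ V → SteinerTree (K n) S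
  steinerTree S⊆V = record
    { subgraph = record
      { V     = V
      ; E     = Edge
      ; edge? = Union.decidable arc? (flip arc?)
      ; symm  = swap
      ; E⊆Adj = λ
        { (inj₁ a) refl → Fin.<-irrefl refl (arc⇒rank> a)
        ; (inj₂ a) refl → Fin.<-irrefl refl (arc⇒rank> a) }
      ; E⇒∈V  = λ
        { (inj₁ ((u∈V , _) , _))        → u∈V
        ; (inj₂ ((v∈V , v≢r) , refl)) → parent∈V v∈V v≢r }
      }
    ; isTree = record
      { nonempty  = root , root∈V
      ; connected = λ u∈V v∈V →
          path-to-root (<-wellFounded _) u∈V ◅◅ reverse swap (path-to-root (<-wellFounded _) v∈V)
      ; acyclic   = acyclic
      }
    ; S⊆V = S⊆V
    }

-- Stars centred outside `S` and double stars inside it.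

members : ∀ {n} (S : Subset n) → Fin ∣ S ∣ → Fin n
members (inside  ∷ S) zero    = zero
members (inside  ∷ S) (suc i) = suc (members S i)
members (outside ∷ S) i       = suc (members S i)

members-∈ : ∀ {n} (S : Subset n) i → members S i ∈ S
members-∈ (inside  ∷ S) zero    = here
members-∈ (inside  ∷ S) (suc i) = there (members-∈ S i)
members-∈ (outside ∷ S) i       = there (members-∈ S i)

members-injective : ∀ {n} (S : Subset n) → Injective _≡_ _≡_ (members S)
members-injective (inside  ∷ S) {zero}  {zero}  _  = refl
members-injective (inside  ∷ S) {suc i} {suc j} eq = cong suc (members-injective S (suc-injective eq))
members-injective (outside ∷ S) eq = members-injective S (suc-injective eq)

module _ {n} (S : Subset n) where

  star : ∀ w → w ∉ S → RootedTree n
  star w w∉S = record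
    { V           = S ∪ ⁅ w ⁆
    ; root        = w
    ; root∈V      = w∈
    ; parent      = λ _ → w
    ; rank        = λ u → level (u ≟ w)
    ; parent∈V    = λ _ _ → w∈
    ; rank-parent = λ _ → descend
    }
    where
    w∈ : w ∈ S ∪ ⁅ w ⁆
    w∈ = q⊆p∪q S ⁅ w ⁆ (x∈⁅x⁆ w)
    level : ∀ {A : Set} → Dec A → Fin 2
    level (yes _) = 0F
    level (no _)  = 1F
    descend : ∀ {u} → u ≢ w → level (w ≟ w) <ᶠ level (u ≟ w)
    descend {u} u≢w with w ≟ w | u ≟ w
    ... | no w≢w | _       = contradiction refl w≢w
    ... | yes _  | yes u≡w = contradiction u≡w u≢w
    ... | yes _  | no _    = z<s

  star-arc : ∀ {w w∉S u v} → RootedTree.Arc (star w w∉S) u v → u ∈ S × v ≡ w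
  star-arc {w} ((u∈V , u≢w) , refl) with x∈p∪q⁻ S ⁅ w ⁆ u∈V
  ... | inj₁ u∈S = u∈S , refl
  ... | inj₂ u∈w = contradiction (x∈⁅y⁆⇒x≡y w u∈w) u≢w

  star-edge : ∀ {w w∉S u v} → RootedTree.Edge (star w w∉S) u v → (u ∈ S × v ≡ w) ⊎ (v ∈ S × u ≡ w)
  star-edge {w∉S = w∉S} (inj₁ a) = inj₁ (star-arc {w∉S = w∉S} a)
  star-edge {w∉S = w∉S} (inj₂ a) = inj₂ (star-arc {w∉S = w∉S} a)

-- The side of pair i to which side x of pair j is attached in the i-th double
-- star.  Between the pairs i < j the i-th tree uses the two parallel edges and
-- the j-th tree the two crossing ones.
side : ∀ {p} → Fin p → Fin p → Fin 2 → Fin 2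
side i j x with Fin.<-cmp i j
... | tri< _ _ _ = x
... | tri≈ _ _ _ = 0F
... | tri> _ _ _ = opposite x

side-same : ∀ {p} (i : Fin p) x → side i i x ≡ 0F
side-same i x with Fin.<-cmp i i
... | tri< i<i _ _ = contradiction i<i (Fin.<-irrefl refl)
... | tri≈ _ _ _   = refl
... | tri> _ _ i<i = contradiction i<i (Fin.<-irrefl refl)

opposite-≢ : ∀ (x : Fin 2) → opposite x ≢ x
opposite-≢ 0F ()
opposite-≢ 1F ()

-- The hypotheses say that the edge between side `x` of pair `i` and side `y` of pair `j` lies in
-- the `i`-th and in the `j`-th double star. One of them reads `x ≡ y` and the other makes `x` and
-- `y` opposite.
side-disjoint : ∀ {p} {i j : Fin p} → i ≢ j → ∀ {x y} → x ≡ side i j y → y ≢ side j i x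
side-disjoint {i = i} {j} i≢j x≡ y≡ with Fin.<-cmp i j | Fin.<-cmp j i
... | tri≈ _ i≡j _ | _            = i≢j i≡j
... | _            | tri≈ _ j≡i _ = i≢j (sym j≡i)
... | tri< i<j _ _ | tri< j<i _ _ = Fin.<-asym i<j j<i
... | tri> _ _ j<i | tri> _ _ i<j = Fin.<-asym i<j j<i
side-disjoint i≢j {y = y} refl y≡ | tri< _ _ _ | tri> _ _ _ = opposite-≢ y (sym y≡)
side-disjoint i≢j {x = x} x≡ refl | tri> _ _ _ | tri< _ _ _ = opposite-≢ x (sym x≡)

-- The pair (aᵢ , bᵢ) is (`vertex i 0F` , `vertex i 1F`); injectivity in both arguments jointly
-- makes the pairs disjoint.
module _ {n p} (S : Subset n) (vertex : Fin p → Fin 2 → Fin n)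
  (vertex∈S  : ∀ i x → vertex i x ∈ S)
  (vertex-injective : ∀ {i x j y} → vertex i x ≡ vertex j y → i ≡ j × x ≡ y) where

  Label : Fin n → Set
  Label u = ∃₂ λ j x → vertex j x ≡ u

  label? : ∀ u → Dec (Label u)
  label? u = any? λ j → any? λ x → vertex j x ≟ u

  module _ (i : Fin p) where

    side-of : ∀ {u} → Dec (Label u) → Fin 2
    side-of (yes (j , x , _)) = side i j x
    -- A vertex in no pair is attached to aᵢ. In the packing below, the only such vertex of `S` is
    -- the one left over when `∣ S ∣` is odd.
    side-of (no _)            = 0F

    attach : Fin n → Fin n
    attach u = vertex i (side-of (label? u))

    level : ∀ {A B : Set} → Dec A → Dec B → Fin 3
    level (yes _) _       = 0F
    level (no _)  (yes _) = 1F
    level (no _)  (no _)  = 2F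

    -- Not the distance from the root aᵢ: neighbours of aᵢ other than bᵢ also get 2. This still
    -- decreases along `attach`, whose values are only aᵢ and bᵢ.
    depth : Fin n → Fin 3
    depth u = level (u ≟ vertex i 0F) (u ≟ vertex i 1F)

    depth-a : depth (vertex i 0F) ≡ 0F
    depth-a with vertex i 0F ≟ vertex i 0F
    ... | yes _   = refl
    ... | no a≢a = contradiction refl a≢a

    depth-b : depth (vertex i 1F) ≡ 1F
    depth-b with vertex i 1F ≟ vertex i 0F | vertex i 1F ≟ vertex i 1F
    ... | yes b≡a | _      = contradiction (sym (proj₂ (vertex-injective b≡a))) 0≢1+n
    ... | no _    | yes _  = refl
    ... | no _    | no b≢b = contradiction refl b≢b

    depth-other : ∀ {u} → u ≢ vertex i 0F → u ≢ vertex i 1F → depth u ≡ 2F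
    depth-other {u} u≢a u≢b with u ≟ vertex i 0F | u ≟ vertex i 1F
    ... | yes u≡a | _       = contradiction u≡a u≢a
    ... | no _    | yes u≡b = contradiction u≡b u≢b
    ... | no _    | no _    = refl

    depth-vertex<2 : ∀ x → depth (vertex i x) <ᶠ (Fin 3 ∋ 2F)
    depth-vertex<2 0F rewrite depth-a = z<s
    depth-vertex<2 1F rewrite depth-b = s<s z<s

    attach-vertex : ∀ j x → attach (vertex j x) ≡ vertex i (side i j x)
    attach-vertex j x with label? (vertex j x)
    ... | no ¬l = contradiction (j , x , refl) ¬l
    ... | yes (j′ , x′ , eq) with vertex-injective eq
    ...   | refl , refl = refl

    attach-b : attach (vertex i 1F) ≡ vertex i 0F
    attach-b = trans (attach-vertex i 1F) (cong (vertex i) (side-same i 1F))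

    depth-attach : ∀ {u} → u ≢ vertex i 0F → depth (attach u) <ᶠ depth u
    depth-attach {u} u≢a = case u ≟ vertex i 1F of λ
      { (yes refl) → subst₂ _<ᶠ_ (sym (trans (cong depth attach-b) depth-a)) (sym depth-b) z<s
      ; (no u≢b)   → subst (depth (attach u) <ᶠ_) (sym (depth-other u≢a u≢b)) (depth-vertex<2 (side-of (label? u))) }

    doubleStar : RootedTree n
    doubleStar = record
      { V           = S
      ; root        = vertex i 0F
      ; root∈V      = vertex∈S i 0F
      ; parent      = attach
      ; rank        = depth
      ; parent∈V    = λ _ _ → vertex∈S i _
      ; rank-parent = λ _ → depth-attach
      }

    doubleStarTree : SteinerTree (K n) S
    doubleStarTree = RootedTree.steinerTree doubleStar (λ u∈S → u∈S)

  arc-end : ∀ {i u v} → RootedTree.Arc (doubleStar i) u v → ∃ λ x → vertex i x ≡ v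
  arc-end (_ , eq) = _ , eq

  -- The head of an arc of the `i`-th double star belongs to pair `i`, so it determines the tree.
  arcs-equidirected : ∀ {i j u v} → RootedTree.Arc (doubleStar i) u v →
                      RootedTree.Arc (doubleStar j) u v → i ≡ j
  arcs-equidirected (_ , p) (_ , q) = proj₁ (vertex-injective (trans p (sym q)))

  -- Each endpoint is the head of one of the two arcs, so the edge joins pair `i` to pair `j`, and
  -- `side-disjoint` decides which of the two trees owns it.
  arcs-opposite : ∀ {i j u v} → i ≢ j → RootedTree.Arc (doubleStar i) u v →
                  ¬ RootedTree.Arc (doubleStar j) v u
  arcs-opposite {i} {j} i≢j a@(_ , p) b@(_ , q) with arc-end {i} a | arc-end {j} b
  ... | x , refl | y , refl = side-disjoint i≢j
    (proj₂ (vertex-injective (trans (sym p) (attach-vertex i j y))))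
    (proj₂ (vertex-injective (trans (sym q) (attach-vertex j i x))))

  doubleStars-disjoint : ∀ {i j} → i ≢ j → EdgeDisjoint (doubleStarTree i) (doubleStarTree j)
  doubleStars-disjoint {i} {j} i≢j (inj₁ a) (inj₁ b) = i≢j (arcs-equidirected {i} {j} a b)
  doubleStars-disjoint {i} {j} i≢j (inj₂ a) (inj₂ b) = i≢j (arcs-equidirected {i} {j} a b)
  doubleStars-disjoint {i} {j} i≢j (inj₁ a) (inj₂ b) = arcs-opposite {i} {j} i≢j a b
  doubleStars-disjoint {i} {j} i≢j (inj₂ a) (inj₁ b) = arcs-opposite {i} {j} i≢j a b

-- The packing that gives the lower bound.

⌊n/2⌋*2≤n : ∀ n → ⌊ n /2⌋ * 2 ≤ n
⌊n/2⌋*2≤n 0             = z≤n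
⌊n/2⌋*2≤n 1             = z≤n
⌊n/2⌋*2≤n (suc (suc n)) = s≤s (s≤s (⌊n/2⌋*2≤n n))

steinerPacking : ∀ {n} (S : Subset n) → SteinerPacking (K n) S (∣ ∁ S ∣ + ⌊ ∣ S ∣ /2⌋)
steinerPacking {n} S = record
  { tree     = tree ∘ splitAt q
  ; disjoint = λ {i} {j} i≢j → disjoint {splitAt q i} {splitAt q j} (i≢j ∘ splitAt-injective)
  }
  where
  p = ⌊ ∣ S ∣ /2⌋
  q = ∣ ∁ S ∣

  vertex : Fin p → Fin 2 → Fin n
  -- Pair `i` consists of the members of `S` with indices 2i and 2i + 1.
  vertex i x = members S (inject≤ (combine i x) (⌊n/2⌋*2≤n ∣ S ∣))

  vertex-injective : ∀ {i x j y} → vertex i x ≡ vertex j y → i ≡ j × x ≡ y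
  vertex-injective eq =
    combine-injective _ _ _ _ (inject≤-injective _ _ _ _ (members-injective S eq))

  centre : Fin q → Fin n
  centre = members (∁ S)

  centre∉S : ∀ i → centre i ∉ S
  centre∉S i = x∈∁p⇒x∉p (members-∈ (∁ S) i)

  tree : Fin q ⊎ Fin p → SteinerTree (K n) S
  tree (inj₁ i) = RootedTree.steinerTree (star S (centre i) (centre∉S i)) (p⊆p∪q _)
  tree (inj₂ i) = doubleStarTree S vertex (λ _ _ → members-∈ S _) vertex-injective i

  disjoint : ∀ {i j} → i ≢ j → EdgeDisjoint (tree i) (tree j)
  disjoint {inj₁ i} {inj₁ j} i≢j e f
    with star-edge S {w∉S = centre∉S i} e | star-edge S {w∉S = centre∉S j} f
  ... | inj₁ (_ , p)   | inj₁ (_ , q)      = i≢j (cong inj₁ (members-injective (∁ S) (trans (sym p) q)))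
  ... | inj₂ (_ , p)   | inj₂ (_ , q)      = i≢j (cong inj₁ (members-injective (∁ S) (trans (sym p) q)))
  ... | inj₁ (u∈S , _) | inj₂ (_ , refl)  = centre∉S j u∈S
  ... | inj₂ (v∈S , _) | inj₁ (_ , refl)  = centre∉S j v∈S
  -- Every edge of a star contains its centre, which is outside `S`, while a double star has vertex
  -- set `S`.
  disjoint {inj₁ i} {inj₂ j} _ e f with star-edge S {w∉S = centre∉S i} e
  ... | inj₁ (_ , refl) = centre∉S i (SteinerTree.E⇒∈V (tree (inj₂ j)) (swap f))
  ... | inj₂ (_ , refl) = centre∉S i (SteinerTree.E⇒∈V (tree (inj₂ j)) f)
  disjoint {inj₂ i} {inj₁ j} i≢j e f = disjoint {inj₁ j} {inj₂ i} (i≢j ∘ sym) f e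
  disjoint {inj₂ i} {inj₂ j} i≢j e f =
    doubleStars-disjoint S vertex (λ _ _ → members-∈ S _) vertex-injective {i} {j}
      (i≢j ∘ cong inj₂) e f

  splitAt-injective : Injective _≡_ _≡_ (splitAt q {p})
  splitAt-injective {i} {j} eq = trans (sym (join-splitAt q p i)) (trans (cong (join q p) eq) (join-splitAt q p j))

-- Indicators and finite sums.

𝟙 : ∀ {a} {A : Set a} → Dec A → ℕ
𝟙 d = if does d then 1 else 0

𝟙-no : ∀ {a} {A : Set a} (d : Dec A) → ¬ A → 𝟙 d ≡ 0
𝟙-no d ¬a rewrite dec-false d ¬a = refl

𝟙-yes : ∀ {a} {A : Set a} (d : Dec A) → A → 𝟙 d ≡ 1
𝟙-yes d a rewrite dec-true d a = refl

𝟙-× : ∀ {a b} {A : Set a} {B : Set b} (d : Dec A) (e : Dec B) → 𝟙 (d ×-dec e) ≡ 𝟙 d * 𝟙 e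
𝟙-× d e with does d
... | true  = sym (*-identityˡ (𝟙 e))
... | false = refl

𝟙-disjoint : ∀ {a b c} {A : Set a} {B : Set b} {C : Set c} (d : Dec A) (e : Dec B) (f : Dec C) →
             (A → C) → (B → C) → (A → ¬ B) → 𝟙 d + 𝟙 e ≤ 𝟙 f
𝟙-disjoint (yes a) (yes b) f _   _   a#b = contradiction b (a#b a)
𝟙-disjoint (yes a) (no _)  f a⇒c _   _   = ≤-reflexive (sym (𝟙-yes f (a⇒c a)))
𝟙-disjoint (no _)  (yes b) f _   b⇒c _   = ≤-reflexive (sym (𝟙-yes f (b⇒c b)))
𝟙-disjoint (no _)  (no _)  f _   _   _   = z≤n

sum-mono-≤ : ∀ {n} {f g : Fin n → ℕ} → (∀ i → f i ≤ g i) → sum f ≤ sum g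
sum-mono-≤ {zero}  f≤g = z≤n
sum-mono-≤ {suc n} f≤g = +-mono-≤ (f≤g zero) (sum-mono-≤ (f≤g ∘ suc))

sum-zero : ∀ {n} {f : Fin n → ℕ} → (∀ i → f i ≡ 0) → sum f ≡ 0
sum-zero {n} f≡0 = trans (sum-cong-≗ f≡0) (sum-replicate-zero n)

sum-𝟙≟ : ∀ {n} (j : Fin n) (f : Fin n → ℕ) → ∑[ i < n ] (𝟙 (j ≟ i) * f i) ≡ f j
sum-𝟙≟ {suc n} zero f = begin
  1 * f zero + ∑[ i < n ] 0 ≡⟨ cong₂ _+_ (*-identityˡ _) (sum-replicate-zero n) ⟩
  f zero + 0                ≡⟨ +-identityʳ _ ⟩
  f zero                    ∎
  where open ≡-Reasoning
sum-𝟙≟ (suc j) f = sum-𝟙≟ j (f ∘ suc)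

sum-𝟙-≤1 : ∀ {n p} {P : Fin n → Set p} (P? : U.Decidable P) →
            (∀ {i j} → P i → P j → i ≡ j) → ∑[ i < n ] 𝟙 (P? i) ≤ 1
sum-𝟙-≤1 {zero}  P? unique = z≤n
sum-𝟙-≤1 {suc n} P? unique with P? zero
... | yes p = s≤s (≤-reflexive (sum-zero λ i → 𝟙-no (P? (suc i)) λ q → 0≢1+n (unique p q)))
... | no  _ = sum-𝟙-≤1 (P? ∘ suc) λ p q → suc-injective (unique p q)

sum-if-∈ : ∀ {n} (S : Subset n) x y →
           ∑[ t < n ] (if does (t ∈? S) then x else y) ≡ ∣ S ∣ * x + ∣ ∁ S ∣ * y
sum-if-∈ []            x y = refl
sum-if-∈ (inside  ∷ S) x y = trans (cong (x +_) (sum-if-∈ S x y)) (sym (+-assoc x _ _))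
sum-if-∈ (outside ∷ S) x y = trans (cong (y +_) (sum-if-∈ S x y))
  (solve 3 (λ a b y → y :+ (a :+ b) := a :+ (y :+ b)) refl (∣ S ∣ * x) (∣ ∁ S ∣ * y) y)
  where open +-*-Solver

sum-if-∈-0 : ∀ {n} (S : Subset n) x → ∑[ t < n ] (if does (t ∈? S) then x else 0) ≡ ∣ S ∣ * x
sum-if-∈-0 S x = trans (sum-if-∈ S x 0) (trans (cong (∣ S ∣ * x +_) (*-zeroʳ ∣ ∁ S ∣)) (+-identityʳ _))

-- Distance to a root.

Minimal : ∀ {p} → (ℕ → Set p) → ℕ → Set p
Minimal P l = P l × (∀ {j} → P j → l ≤ j)

minimal-witness : ∀ {p} {P : ℕ → Set p} → U.Decidable P → ∃ P → ∃ (Minimal P)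
minimal-witness {P = P} P? (b , Pb) = go b P? Pb
  where
  go : ∀ {p} {P : ℕ → Set p} b → U.Decidable P → P b → ∃ (Minimal P)
  go zero    P? Pb = 0 , Pb , λ _ → z≤n
  go (suc b) P? Pb with P? 0
  ... | yes P0 = 0 , P0 , λ _ → z≤n
  ... | no ¬P0 with go b (P? ∘ suc) Pb
  ...   | l , Pl , l-min = suc l , Pl , λ { {zero} P0 → contradiction P0 ¬P0 ; {suc j} Pj → s≤s (l-min Pj) }

module _ {n} {E : Rel (Fin n) 0ℓ} (edge? : Decidable E) (V : Subset n)
  {r} (connected : ∀ {u} → u ∈ V → Star E u r) where

  -- Fixing the length makes existence of a walk decidable by search over the vertices, so a
  -- shortest length can be computed from any given path.
  Walk : ℕ → Fin n → Set
  Walk zero    u = u ≡ r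
  Walk (suc l) u = ∃ λ v → E u v × Walk l v

  walk? : ∀ l u → Dec (Walk l u)
  walk? zero    u = u ≟ r
  walk? (suc l) u = any? λ v → edge? u v ×-dec walk? l v

  walk : ∀ {u} → Star E u r → ∃ λ l → Walk l u
  walk ε       = 0 , refl
  walk (e ◅ p) with walk p
  ... | l , w = suc l , _ , e , w

  minimal-distance : ∀ u → ∃ λ l → u ∈ V → Minimal (flip Walk u) l
  minimal-distance u with u ∈? V
  -- A default that makes the distance total; minimality is claimed on `V` only.
  ... | no u∉V  = 0 , λ u∈V → contradiction u∈V u∉V
  ... | yes u∈V with minimal-witness (flip walk? u) (walk (connected u∈V))
  ...   | l , l-min = l , λ _ → l-min

  distance : Fin n → ℕ
  distance = proj₁ ∘ minimal-distance

  -- The first step of a shortest walk from `u` leaves a walk that is shorter by one and bounds the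
  -- distance of the next vertex.
  closer : ∀ {u} → u ∈ V → u ≢ r → (∀ {v} → E u v → v ∈ V) → ∃ λ v → E u v × distance v < distance u
  closer {u} u∈V u≢r nb∈V with distance u | proj₂ (minimal-distance u) u∈V
  ... | zero  | u≡r , _           = contradiction u≡r u≢r
  ... | suc l | (v , e , w) , _ = v , e , s≤s (proj₂ (proj₂ (minimal-distance v) (nb∈V e)) w)

-- Charging the vertices of `S` to edges of a connected subgraph.

module _ {n} {E : Rel (Fin n) 0ℓ} (edge? : Decidable E) (E-sym : Symmetric E)
  (V S : Subset n) (E⇒∈V : ∀ {u v} → E u v → u ∈ V) (S⊆V : S ⊆ V)
  {r} (connected : ∀ {u} → u ∈ V → Star E u r) where

  private
    dist : Fin n → ℕ
    dist = distance edge? V connected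

    Closer : Fin n → Fin n → Set
    Closer u v = E u v × dist v < dist u

    parent-of : ∀ {u} → Dec (∃ (Closer u)) → Fin n
    parent-of     (yes (v , _)) = v
    -- A default value, which `parent-closer` rules out for vertices of `S` other than the root.
    parent-of {u} (no _)        = u

    closer? : ∀ u → Dec (∃ (Closer u))
    closer? u = any? λ v → edge? u v ×-dec dist v <? dist u

    parent : Fin n → Fin n
    parent u = parent-of (closer? u)

    parent-closer : ∀ {u} → u ∈ S → u ≢ r → Closer u (parent u)
    parent-closer {u} u∈S u≢r with closer? u
    ... | yes (_ , c) = c
    ... | no ¬c = contradiction (closer edge? V connected (S⊆V u∈S) u≢r (E⇒∈V ∘ E-sym)) ¬c

    -- The vertices that charge an edge, namely the one to their parent.
    Child : Fin n → Set
    Child u = u ∈ S × u ≢ r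

    child? : ∀ u → Dec (Child u)
    child? u = u ∈? S ×-dec ¬? (u ≟ r)

    Arc : Fin n → Fin n → Set
    Arc s t = Child s × parent s ≡ t

    arc? : Decidable Arc
    arc? s t = child? s ×-dec (parent s ≟ t)

    arc : Fin n → Fin n → ℕ
    arc s t = 𝟙 (arc? s t)

    arc⇒closer : ∀ {s t} → Arc s t → Closer s t
    arc⇒closer ((s∈S , s≢r) , refl) = parent-closer s∈S s≢r

    -- The distance drops strictly along an arc, so no edge is charged from both of its ends.
    arc-pair≤edge : ∀ s t → arc s t + arc t s ≤ 𝟙 (edge? s t)
    arc-pair≤edge s t = 𝟙-disjoint (arc? s t) (arc? t s) (edge? s t)
      (proj₁ ∘ arc⇒closer) (E-sym ∘ proj₁ ∘ arc⇒closer)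
      (λ a b → <-asym (proj₂ (arc⇒closer a)) (proj₂ (arc⇒closer b)))

    children≥ : ∣ S ∣ ∸ 𝟙 (r ∈? S) ≤ ∑[ s < n ] 𝟙 (child? s)
    children≥ = m≤n+o⇒m∸n≤o ∣ S ∣ (𝟙 (r ∈? S)) (begin
      ∣ S ∣                                                  ≡⟨ *-identityʳ ∣ S ∣ ⟨
      ∣ S ∣ * 1                                              ≡⟨ sum-if-∈-0 S 1 ⟨
      ∑[ s < n ] 𝟙 (s ∈? S)                                  ≤⟨ sum-mono-≤ pointwise ⟩
      ∑[ s < n ] (𝟙 (r ≟ s) * 𝟙 (s ∈? S) + 𝟙 (child? s))    ≡⟨ ∑-distrib-+ (λ s → 𝟙 (r ≟ s) * 𝟙 (s ∈? S)) _ ⟩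
      ∑[ s < n ] (𝟙 (r ≟ s) * 𝟙 (s ∈? S)) + ∑[ s < n ] 𝟙 (child? s)
                                                             ≡⟨ cong (_+ ∑[ s < n ] 𝟙 (child? s)) (sum-𝟙≟ r (λ s → 𝟙 (s ∈? S))) ⟩
      𝟙 (r ∈? S) + ∑[ s < n ] 𝟙 (child? s)                   ∎)
      where
      open ≤-Reasoning
      pointwise : ∀ s → 𝟙 (s ∈? S) ≤ 𝟙 (r ≟ s) * 𝟙 (s ∈? S) + 𝟙 (child? s)
      pointwise s with s ∈? S | s ≟ r | r ≟ s
      ... | no _  | _       | _       = z≤n
      ... | yes _ | no _    | _       = m≤n+m 1 _
      ... | yes _ | yes _   | yes _   = s≤s z≤n
      ... | yes _ | yes s≡r | no r≢s = contradiction (sym s≡r) r≢s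

  -- An edge between `s` and `t` weighs `W s t + W t s`, since the double sum meets both
  -- orientations. Each child charges an edge of weight at least `c`, and different children charge
  -- different edges.
  edge-weight≥ : ∀ (W : Fin n → Fin n → ℕ) {c} →
                 (∀ {s t} → s ∈ S → t ∈ V → c ≤ W s t + W t s) →
                 (∣ S ∣ ∸ 𝟙 (r ∈? S)) * c ≤ ∑[ s < n ] ∑[ t < n ] (𝟙 (edge? s t) * W s t)
  edge-weight≥ W {c} c≤W = begin
    (∣ S ∣ ∸ 𝟙 (r ∈? S)) * c
      ≤⟨ *-monoˡ-≤ c children≥ ⟩
    (∑[ s < n ] 𝟙 (child? s)) * c
      ≡⟨ *-distribʳ-sum c (𝟙 ∘ child?) ⟩
    ∑[ s < n ] (𝟙 (child? s) * c)
      ≤⟨ sum-mono-≤ row ⟩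
    ∑[ s < n ] ∑[ t < n ] (arc s t * (W s t + W t s))
      ≡⟨ sum-cong-≗ (λ s → trans (sum-cong-≗ λ t → *-distribˡ-+ (arc s t) (W s t) (W t s)) (∑-distrib-+ (λ t → arc s t * W s t) _)) ⟩
    ∑[ s < n ] (∑[ t < n ] (arc s t * W s t) + ∑[ t < n ] (arc s t * W t s))
      ≡⟨ ∑-distrib-+ (λ s → ∑[ t < n ] (arc s t * W s t)) _ ⟩
    ∑[ s < n ] ∑[ t < n ] (arc s t * W s t) + ∑[ s < n ] ∑[ t < n ] (arc s t * W t s)
      -- Renaming the summation variables moves the reversal from the weight to the arc, so that
      -- both arcs on an ordered pair multiply the same `W s t`.
      ≡⟨ cong (∑[ s < n ] ∑[ t < n ] (arc s t * W s t) +_) (∑-comm (λ s t → arc s t * W t s)) ⟩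
    ∑[ s < n ] ∑[ t < n ] (arc s t * W s t) + ∑[ s < n ] ∑[ t < n ] (arc t s * W s t)
      ≡⟨ ∑-distrib-+ (λ s → ∑[ t < n ] (arc s t * W s t)) _ ⟨
    ∑[ s < n ] (∑[ t < n ] (arc s t * W s t) + ∑[ t < n ] (arc t s * W s t))
      ≡⟨ sum-cong-≗ (λ s → trans (sum-cong-≗ λ t → *-distribʳ-+ (W s t) (arc s t) (arc t s)) (∑-distrib-+ (λ t → arc s t * W s t) _)) ⟨
    ∑[ s < n ] ∑[ t < n ] ((arc s t + arc t s) * W s t)
      ≤⟨ sum-mono-≤ (λ s → sum-mono-≤ λ t → *-monoˡ-≤ (W s t) (arc-pair≤edge s t)) ⟩
    ∑[ s < n ] ∑[ t < n ] (𝟙 (edge? s t) * W s t) ∎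
    where
    open ≤-Reasoning
    row : ∀ s → 𝟙 (child? s) * c ≤ ∑[ t < n ] (arc s t * (W s t + W t s))
    row s = begin
      𝟙 (child? s) * c
        ≤⟨ bound (child? s) ⟩
      𝟙 (child? s) * (W s (parent s) + W (parent s) s)
        ≡⟨ cong (𝟙 (child? s) *_) (sum-𝟙≟ (parent s) (λ t → W s t + W t s)) ⟨
      𝟙 (child? s) * ∑[ t < n ] (𝟙 (parent s ≟ t) * (W s t + W t s))
        ≡⟨ *-distribˡ-sum (𝟙 (child? s)) (λ t → 𝟙 (parent s ≟ t) * (W s t + W t s)) ⟩
      ∑[ t < n ] (𝟙 (child? s) * (𝟙 (parent s ≟ t) * (W s t + W t s)))
        ≡⟨ sum-cong-≗ (λ t → trans (cong (_* (W s t + W t s)) (𝟙-× (child? s) (parent s ≟ t))) (*-assoc (𝟙 (child? s)) _ _)) ⟨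
      ∑[ t < n ] (arc s t * (W s t + W t s)) ∎
      where
      bound : (d : Dec (Child s)) → 𝟙 d * c ≤ 𝟙 d * (W s (parent s) + W (parent s) s)
      bound (no _)            = z≤n
      bound (yes (s∈S , s≢r)) =
        *-monoʳ-≤ 1 (c≤W s∈S (E⇒∈V (E-sym (proj₁ (parent-closer s∈S s≢r)))))

-- The upper bound on the size of a packing.

m*c≤sum : ∀ {m c} {f : Fin m → ℕ} → (∀ i → c ≤ f i) → m * c ≤ sum f
m*c≤sum {zero}  c≤f = z≤n
m*c≤sum {suc m} c≤f = +-mono-≤ (c≤f zero) (m*c≤sum (c≤f ∘ suc))

-- The diagonal, not being an edge, acts as one more member of the packing.
packing-weight≤ : ∀ {n m} {S : Subset n} (P : SteinerPacking (K n) S m) (W : Fin n → Fin n → ℕ) {c} →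
                  (∀ (T : SteinerTree (K n) S) →
                    c ≤ ∑[ s < n ] ∑[ t < n ] (𝟙 (SteinerTree.edge? T s t) * W s t)) →
                  ∑[ s < n ] W s s + m * c ≤ ∑[ s < n ] ∑[ t < n ] W s t
packing-weight≤ {n} {m} P W {c} c≤ = begin
  ∑[ s < n ] W s s + m * c
    ≤⟨ +-mono-≤ (≤-reflexive (sum-cong-≗ λ s → sym (sum-𝟙≟ s (W s)))) (m*c≤sum (c≤ ∘ tree)) ⟩
  ∑[ s < n ] ∑[ t < n ] (𝟙 (s ≟ t) * W s t) + ∑[ i < m ] ∑[ s < n ] ∑[ t < n ] (𝟙 (edge? i s t) * W s t)
    ≡⟨ cong (∑[ s < n ] ∑[ t < n ] (𝟙 (s ≟ t) * W s t) +_)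
            (trans (∑-comm λ i s → ∑[ t < n ] (𝟙 (edge? i s t) * W s t))
                   (sum-cong-≗ λ s → ∑-comm λ i t → 𝟙 (edge? i s t) * W s t)) ⟩
  ∑[ s < n ] ∑[ t < n ] (𝟙 (s ≟ t) * W s t) + ∑[ s < n ] ∑[ t < n ] ∑[ i < m ] (𝟙 (edge? i s t) * W s t)
    ≡⟨ ∑-distrib-+ (λ s → ∑[ t < n ] (𝟙 (s ≟ t) * W s t)) _ ⟨
  ∑[ s < n ] (∑[ t < n ] (𝟙 (s ≟ t) * W s t) + ∑[ t < n ] ∑[ i < m ] (𝟙 (edge? i s t) * W s t))
    ≡⟨ (sum-cong-≗ λ s → ∑-distrib-+ (λ t → 𝟙 (s ≟ t) * W s t) _) ⟨
  ∑[ s < n ] ∑[ t < n ] (∑[ i < suc m ] (𝟙 (member? s t i) * W s t))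
    ≡⟨ (sum-cong-≗ λ s → sum-cong-≗ λ t → *-distribʳ-sum (W s t) (𝟙 ∘ member? s t)) ⟨
  ∑[ s < n ] ∑[ t < n ] ((∑[ i < suc m ] 𝟙 (member? s t i)) * W s t)
    ≤⟨ (sum-mono-≤ λ s → sum-mono-≤ λ t → *-monoˡ-≤ (W s t) (sum-𝟙-≤1 (member? s t) (unique s t))) ⟩
  ∑[ s < n ] ∑[ t < n ] (1 * W s t)
    ≡⟨ (sum-cong-≗ λ s → sum-cong-≗ λ t → *-identityˡ (W s t)) ⟩
  ∑[ s < n ] ∑[ t < n ] W s t ∎
  where
  open ≤-Reasoning
  open SteinerPacking P
  edge? : ∀ i → Decidable (SteinerTree.E (tree i))
  edge? i = SteinerTree.edge? (tree i)
  Member : Fin n → Fin n → Fin (suc m) → Set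
  Member s t zero    = s ≡ t
  Member s t (suc i) = SteinerTree.E (tree i) s t
  member? : ∀ s t → U.Decidable (Member s t)
  member? s t zero    = s ≟ t
  member? s t (suc i) = edge? i s t
  unique : ∀ s t {i j} → Member s t i → Member s t j → i ≡ j
  unique s t {zero}  {zero}  _   _   = refl
  unique s t {zero}  {suc j} s≡t e   = contradiction s≡t (SteinerTree.E⊆Adj (tree j) e)
  unique s t {suc i} {zero}  e   s≡t = contradiction s≡t (SteinerTree.E⊆Adj (tree i) e)
  unique s t {suc i} {suc j} e   f   =
    cong suc (decidable-stable (i ≟ j) λ i≢j → disjoint i≢j e f)

-- The edge weights 1/(k−1) and 1/k, scaled by 2k(k−1) where k = 2 + j.  The
-- weight of an edge inside S is split evenly between its two orientations; that
-- of an edge leaving S is put on the orientation away from S.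
module _ {n} (S : Subset n) {j} (∣S∣≡2+j : ∣ S ∣ ≡ 2 + j) where

  weight : Fin n → Fin n → ℕ
  weight s t = if does (s ∈? S) then (if does (t ∈? S) then 2 + j else 2 * (1 + j)) else 0

  weight-inner : ∀ {s t} → s ∈ S → t ∈ S → weight s t ≡ 2 + j
  weight-inner {s} {t} s∈S t∈S rewrite dec-true (s ∈? S) s∈S | dec-true (t ∈? S) t∈S = refl

  weight-outer : ∀ {s t} → s ∈ S → t ∉ S → weight s t ≡ 2 * (1 + j)
  weight-outer {s} {t} s∈S t∉S rewrite dec-true (s ∈? S) s∈S | dec-false (t ∈? S) t∉S = refl

  -- With a root outside `S`, all k vertices of `S` charge edges of scaled weight at least 2(k-1).
  -- If the tree stays inside `S`, only k-1 vertices charge, but every edge weighs 2k. Both products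
  -- are 2k(k-1).
  tree-weight≥ : (T : SteinerTree (K n) S) →
                 (2 + j) * (2 * (1 + j)) ≤ ∑[ s < n ] ∑[ t < n ] (𝟙 (SteinerTree.edge? T s t) * weight s t)
  tree-weight≥ T = by-cases (any? λ u → u ∈? V ×-dec ¬? (u ∈? S))
    where
    open SteinerTree T
    open ≤-Reasoning
    rooted-at : ∀ {r} → r ∈ V → ∀ {c} → (∀ {s t} → s ∈ S → t ∈ V → c ≤ weight s t + weight t s) →
                (∣ S ∣ ∸ 𝟙 (r ∈? S)) * c ≤ ∑[ s < n ] ∑[ t < n ] (𝟙 (edge? s t) * weight s t)
    rooted-at r∈V = edge-weight≥ edge? symm V S E⇒∈V S⊆V (λ u∈V → IsTree.connected isTree u∈V r∈V) weight

    inner : ∀ {s t} → s ∈ S → t ∈ S → weight s t + weight t s ≡ 2 * (2 + j)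
    inner s∈S t∈S rewrite weight-inner s∈S t∈S | weight-inner t∈S s∈S =
      cong (2 + j +_) (sym (+-identityʳ (2 + j)))

    by-cases : Dec (∃ λ u → u ∈ V × u ∉ S) →
               (2 + j) * (2 * (1 + j)) ≤ ∑[ s < n ] ∑[ t < n ] (𝟙 (edge? s t) * weight s t)
    by-cases (yes (r , r∈V , r∉S)) = begin
      (2 + j) * (2 * (1 + j))                  ≡⟨ cong (_* (2 * (1 + j))) size ⟨
      (∣ S ∣ ∸ 𝟙 (r ∈? S)) * (2 * (1 + j))   ≤⟨ rooted-at r∈V (λ {s} {t} s∈S _ → pair s∈S (t ∈? S)) ⟩
      _                                        ∎
      where
      size : ∣ S ∣ ∸ 𝟙 (r ∈? S) ≡ 2 + j
      size rewrite dec-false (r ∈? S) r∉S = ∣S∣≡2+j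
      pair : ∀ {s t} → s ∈ S → Dec (t ∈ S) → 2 * (1 + j) ≤ weight s t + weight t s
      pair s∈S (yes t∈S) = ≤-trans (*-monoʳ-≤ 2 (n≤1+n (1 + j))) (≤-reflexive (sym (inner s∈S t∈S)))
      pair s∈S (no t∉S)  = ≤-trans (≤-reflexive (sym (weight-outer s∈S t∉S))) (m≤m+n _ _)
    by-cases (no V⊈S) with IsTree.nonempty isTree
    ... | r , r∈V = begin
      (2 + j) * (2 * (1 + j))                  ≡⟨ solve 1 (λ j → (con 2 :+ j) :* (con 2 :* (con 1 :+ j)) := (con 1 :+ j) :* (con 2 :* (con 2 :+ j))) refl j ⟩
      (1 + j) * (2 * (2 + j))                  ≡⟨ cong (_* (2 * (2 + j))) size ⟨
      (∣ S ∣ ∸ 𝟙 (r ∈? S)) * (2 * (2 + j))   ≤⟨ rooted-at r∈V (λ s∈S t∈V → ≤-reflexive (sym (inner s∈S (V⊆S t∈V)))) ⟩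
      _                                        ∎
      where
      open +-*-Solver
      V⊆S : V ⊆ S
      V⊆S {u} u∈V = decidable-stable (u ∈? S) λ u∉S → V⊈S (u , u∈V , u∉S)
      size : ∣ S ∣ ∸ 𝟙 (r ∈? S) ≡ 1 + j
      size rewrite dec-true (r ∈? S) (V⊆S r∈V) = cong (_∸ 1) ∣S∣≡2+j

  -- The sum includes the diagonal, so it exceeds the weight of the edges of `K n` by the amount in
  -- `diagonal-weight`.
  total-weight : ∑[ s < n ] ∑[ t < n ] weight s t ≡
                 (2 + j) * ((2 + j) * (2 + j) + ∣ ∁ S ∣ * (2 * (1 + j)))
  total-weight = begin
    ∑[ s < n ] ∑[ t < n ] weight s t                       ≡⟨ sum-cong-≗ row ⟩
    ∑[ s < n ] (if does (s ∈? S) then rowTotal else 0)     ≡⟨ sum-if-∈-0 S rowTotal ⟩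
    ∣ S ∣ * rowTotal                                       ≡⟨ cong (λ k → k * (k * (2 + j) + ∣ ∁ S ∣ * (2 * (1 + j)))) ∣S∣≡2+j ⟩
    (2 + j) * ((2 + j) * (2 + j) + ∣ ∁ S ∣ * (2 * (1 + j))) ∎
    where
    open ≡-Reasoning
    rowTotal : ℕ
    rowTotal = ∣ S ∣ * (2 + j) + ∣ ∁ S ∣ * (2 * (1 + j))
    row : ∀ s → ∑[ t < n ] weight s t ≡ (if does (s ∈? S) then rowTotal else 0)
    row s with does (s ∈? S)
    ... | true  = sum-if-∈ S (2 + j) (2 * (1 + j))
    ... | false = sum-replicate-zero n

  diagonal-weight : ∑[ s < n ] weight s s ≡ (2 + j) * (2 + j)
  diagonal-weight = trans (sum-cong-≗ diagonal) (trans (sum-if-∈-0 S (2 + j)) (cong (_* (2 + j)) ∣S∣≡2+j))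
    where
    diagonal : ∀ s → weight s s ≡ (if does (s ∈? S) then 2 + j else 0)
    diagonal s with does (s ∈? S)
    ... | true  = refl
    ... | false = refl

  -- With d = `∣ ∁ S ∣`, weighing gives k² + 2mk(k-1) ≤ k(k² + 2d(k-1)). Dividing by k, subtracting
  -- k and dividing by k-1 leaves the claim, which is kept doubled to avoid the fraction k/2.
  m+m≤d+d+k : ∀ {m} → SteinerPacking (K n) S m → m + m ≤ (∣ ∁ S ∣ + ∣ ∁ S ∣) + ∣ S ∣
  m+m≤d+d+k {m} P rewrite ∣S∣≡2+j = *-cancelˡ-≤ (1 + j) (+-cancelˡ-≤ (2 + j) _ _ (*-cancelˡ-≤ (2 + j) (begin
    (2 + j) * ((2 + j) + (1 + j) * (m + m))
      ≡⟨ solve 2 (λ j m → let k = con 2 :+ j; q = con 1 :+ j in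
           k :* (k :+ q :* (m :+ m)) := k :* k :+ m :* (k :* (con 2 :* q))) refl j m ⟩
    (2 + j) * (2 + j) + m * ((2 + j) * (2 * (1 + j)))
      ≡⟨ cong (_+ m * ((2 + j) * (2 * (1 + j)))) diagonal-weight ⟨
    ∑[ s < n ] weight s s + m * ((2 + j) * (2 * (1 + j)))
      ≤⟨ packing-weight≤ P weight tree-weight≥ ⟩
    ∑[ s < n ] ∑[ t < n ] weight s t
      ≡⟨ total-weight ⟩
    (2 + j) * ((2 + j) * (2 + j) + ∣ ∁ S ∣ * (2 * (1 + j)))
      -- Here k² is split as k + (k-1)k, which exposes the factor k-1.
      ≡⟨ solve 2 (λ j d → let k = con 2 :+ j; q = con 1 :+ j in
           k :* (k :* k :+ d :* (con 2 :* q)) := k :* (k :+ q :* ((d :+ d) :+ k))) refl j (∣ ∁ S ∣) ⟩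
    (2 + j) * ((2 + j) + (1 + j) * ((∣ ∁ S ∣ + ∣ ∁ S ∣) + (2 + j))) ∎)))
    where
    open ≤-Reasoning
    open +-*-Solver

⌊d+d+k/2⌋≡d+⌊k/2⌋ : ∀ d k → ⌊ d + d + k /2⌋ ≡ d + ⌊ k /2⌋
⌊d+d+k/2⌋≡d+⌊k/2⌋ zero    k = refl
⌊d+d+k/2⌋≡d+⌊k/2⌋ (suc d) k rewrite +-suc d d = cong suc (⌊d+d+k/2⌋≡d+⌊k/2⌋ d k)

-- Since `m` is an integer, halving the doubled bound may round k/2 down.
steinerPacking-≤ : ∀ {n} (S : Subset n) → 2 ≤ ∣ S ∣ → ∀ {m} → SteinerPacking (K n) S m →
                   m ≤ ∣ ∁ S ∣ + ⌊ ∣ S ∣ /2⌋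
steinerPacking-≤ S 2≤∣S∣ {m} P = begin
  m                                  ≡⟨ n≡⌊n+n/2⌋ m ⟩
  ⌊ m + m /2⌋                        ≤⟨ ⌊n/2⌋-mono (m+m≤d+d+k S (sym (m+[n∸m]≡n 2≤∣S∣)) P) ⟩
  ⌊ (∣ ∁ S ∣ + ∣ ∁ S ∣) + ∣ S ∣ /2⌋ ≡⟨ ⌊d+d+k/2⌋≡d+⌊k/2⌋ ∣ ∁ S ∣ ∣ S ∣ ⟩
  ∣ ∁ S ∣ + ⌊ ∣ S ∣ /2⌋              ∎
  where open ≤-Reasoning

-- The value of the generalized edge-connectivity.

n∸⌈k/2⌉≡n∸k+⌊k/2⌋ : ∀ {n k} → k ≤ n → n ∸ ⌈ k /2⌉ ≡ (n ∸ k) + ⌊ k /2⌋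
n∸⌈k/2⌉≡n∸k+⌊k/2⌋ {n} {k} k≤n = begin
  n ∸ ⌈ k /2⌉                                    ≡⟨ cong (_∸ ⌈ k /2⌉) (m∸n+n≡m k≤n) ⟨
  (n ∸ k) + k ∸ ⌈ k /2⌉                          ≡⟨ cong (λ l → (n ∸ k) + l ∸ ⌈ k /2⌉) (⌊n/2⌋+⌈n/2⌉≡n k) ⟨
  (n ∸ k) + (⌊ k /2⌋ + ⌈ k /2⌉) ∸ ⌈ k /2⌉      ≡⟨ cong (_∸ ⌈ k /2⌉) (+-assoc (n ∸ k) ⌊ k /2⌋ ⌈ k /2⌉) ⟨
  (n ∸ k) + ⌊ k /2⌋ + ⌈ k /2⌉ ∸ ⌈ k /2⌉        ≡⟨ m+n∸n≡m ((n ∸ k) + ⌊ k /2⌋) ⌈ k /2⌉ ⟩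
  (n ∸ k) + ⌊ k /2⌋                              ∎
  where open ≡-Reasoning

subset-of-size : ∀ {n k} → k ≤ n → ∃ λ (S : Subset n) → ∣ S ∣ ≡ k
subset-of-size {n} z≤n = ⊥ , ∣⊥∣≡0 n
subset-of-size (s≤s k≤n) with subset-of-size k≤n
... | S , ∣S∣≡k = inside ∷ S , cong suc ∣S∣≡k

theorem3 : ∀ (n k : ℕ) → 2 ≤ k → k ≤ n → IsGeneralizedλ (K n) k (n ∸ ⌈ k /2⌉)
theorem3 n k 2≤k k≤n = record
  -- The local value depends on `∣ S ∣` alone, so any set of size `k` attains the minimum, and the
  -- inequality in `minimal` is an equality.
  { attained = let S , ∣S∣≡k = subset-of-size k≤n in S , ∣S∣≡k , localλ S ∣S∣≡k
  ; minimal  = λ S ∣S∣≡k → _ , localλ S ∣S∣≡k , ≤-refl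
  }
  where
  localλ : ∀ S → ∣ S ∣ ≡ k → IsLocalλ (K n) S (n ∸ ⌈ k /2⌉)
  localλ S refl = subst (IsLocalλ (K n) S) (sym value) record
    { packing = steinerPacking S
    ; maximal = λ _ → steinerPacking-≤ S 2≤k
    }
    where
    value : n ∸ ⌈ ∣ S ∣ /2⌉ ≡ ∣ ∁ S ∣ + ⌊ ∣ S ∣ /2⌋
    value = trans (n∸⌈k/2⌉≡n∸k+⌊k/2⌋ k≤n) (cong (_+ ⌊ ∣ S ∣ /2⌋) (sym (∣∁p∣≡n∸∣p∣ S)))
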